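{- Let $k\ge 1$ and let $G$ be a graph of order $n$ with minimum degree $\delta\ge k+1$. Then $\Gamma_{\times k,t}(G)\le n-\delta+k$. Moreover the bound is sharp: for all integers $\delta\ge k+1\ge 2$ and $b\ge\lceil \delta/(k+1)\rceil$, the join $G_b=H_b\vee T$, where $H_b$ is the disjoint union of $b$ copies of $K_{k+1}$ and $T$ is an edgeless graph on $\delta-k$ vertices, has minimum degree $\delta$, order $n=b(k+1)+\delta-k$, and $\Gamma_{\times k,t}(G_b)=n-\delta+k$.
   Context: A set $S\subseteq V(G)$ is a $k$-tuple total dominating set ($k$TDS) of a graph $G$ with $\delta(G)\ge k$ if $|N_G(x)\cap S|\ge k$ for every $x\in V(G)$. The upper $k$-tuple total domination number $\Gamma_{\times k,t}(G)$ is the maximum cardinality of a minimal (with respect to inclusion) $k$TDS of $G$. The join $A\vee B$ of disjoint graphs is their union together with all edges between $V(A)$ and $V(B)$. -}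

module Defs where

open import Data.Empty using (⊥)
open import Data.Fin.Base using (Fin; splitAt; remQuot)
open import Data.Fin.Properties using (_≟_; all?)
open import Data.Fin.Subset using (Subset; inside; outside; ∣_∣; _∩_; _⊂_)
open import Data.Fin.Subset.Properties using (_⊂?_; anySubset?)
open import Data.List.Base using (List; []; _∷_; _++_; map; filter; allFin)
open import Data.List.Extrema.Nat using (max; min)
open import Data.Nat.Base using (ℕ; zero; suc; pred; _+_; _*_; _∸_; _≥_; NonZero)
open import Data.Nat.DivMod using (_/_)
open import Data.Nat.Properties using (_≥?_)
open import Data.Product.Base using (_×_; _,_; ∃)
open import Data.Sum.Base using (_⊎_; inj₁; inj₂)
open import Data.Unit.Base using (⊤; tt)
open import Data.Vec.Base as Vec using (tabulate)
open import Level using (0ℓ)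
open import Relation.Binary.Core using (Rel)
open import Relation.Binary.Definitions using (Decidable; Symmetric; Irreflexive)
open import Relation.Binary.PropositionalEquality using (_≡_; _≢_; refl; sym)
open import Relation.Nullary using (Dec; yes; no; does; ¬_)
open import Relation.Nullary.Decidable using (¬?; _×-dec_)

record Graph : Set₁ where
  field
    order  : ℕ
    Adj    : Rel (Fin order) 0ℓ
    adj?   : Decidable Adj
    symm   : Symmetric Adj
    irrefl : Irreflexive _≡_ Adj

  V : Set
  V = Fin order

  N : V → Subset order
  N x = tabulate (λ y → does (adj? x y))

  degree : V → ℕ
  degree x = ∣ N x ∣

open Graph using (order)

-- Every degree in a nonempty graph is below its order, so the initial value
-- `order G` never affects the minimum there; for the empty graph δ G is 0.
δ : Graph → ℕ
δ G = min (order G) (map (Graph.degree G) (allFin (order G)))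

module _ (k : ℕ) (G : Graph) where
  open Graph G using (N; V)

  IsTDS : Subset (order G) → Set
  IsTDS S = ∀ (x : V) → ∣ N x ∩ S ∣ ≥ k

  IsMinimalTDS : Subset (order G) → Set
  IsMinimalTDS S = IsTDS S × ¬ ∃ λ T → T ⊂ S × IsTDS T

  isTDS? : ∀ S → Dec (IsTDS S)
  isTDS? S = all? λ x → ∣ N x ∩ S ∣ ≥? k

  isMinimalTDS? : ∀ S → Dec (IsMinimalTDS S)
  isMinimalTDS? S =
    isTDS? S ×-dec ¬? (anySubset? λ T → (T ⊂? S) ×-dec isTDS? T)

allSubsets : ∀ n → List (Subset n)
allSubsets zero    = Vec.[] ∷ []
allSubsets (suc n) =
  map (outside Vec.∷_) (allSubsets n) ++ map (inside Vec.∷_) (allSubsets n)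

-- If δ G ≥ k then the whole vertex set is a k-tuple total dominating set, so
-- minimal ones exist and the maximum is over a nonempty family; the initial
-- value 0 matters only when there are none (in which case Γ k G is 0).
Γ : ℕ → Graph → ℕ
Γ k G = max 0 (map ∣_∣ (filter (isMinimalTDS? k G) (allSubsets (order G))))

complete : ℕ → Graph
complete n = record
  { order  = n
  ; Adj    = _≢_
  ; adj?   = λ x y → ¬? (x ≟ y)
  ; symm   = λ x≢y y≡x → x≢y (sym y≡x)
  ; irrefl = λ x≡y x≢y → x≢y x≡y
  }

edgeless : ℕ → Graph
edgeless n = record
  { order  = n
  ; Adj    = λ _ _ → ⊥
  ; adj?   = λ _ _ → no λ ()
  ; symm   = λ ()
  ; irrefl = λ _ ()
  }

-- The disjoint union of b copies of G: `remQuot` splits a vertex into the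
-- index of its copy and the vertex of G it represents.
copies : ℕ → Graph → Graph
copies b G = record
  { order  = b * order G
  ; Adj    = λ x y → AdjC (remQuot (order G) x) (remQuot (order G) y)
  ; adj?   = λ x y → adjC? (remQuot (order G) x) (remQuot (order G) y)
  ; symm   = λ (i≡j , uv) → sym i≡j , symm uv
  ; irrefl = λ { refl (_ , uu) → irrefl refl uu }
  }
  where
  open Graph G using (V; Adj; adj?; symm; irrefl)

  AdjC : Rel (Fin b × V) 0ℓ
  AdjC (i , u) (j , v) = i ≡ j × Adj u v

  adjC? : Decidable AdjC
  adjC? (i , u) (j , v) = (i ≟ j) ×-dec adj? u v

infixr 6 _∨_

-- `splitAt` identifies the vertices with the disjoint union of those of A and B.
_∨_ : Graph → Graph → Graph
A ∨ B = record
  { order  = order A + order B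
  ; Adj    = λ x y → AdjJ (splitAt (order A) x) (splitAt (order A) y)
  ; adj?   = λ x y → adjJ? (splitAt (order A) x) (splitAt (order A) y)
  ; symm   = λ {x} {y} → symmJ (splitAt (order A) x) (splitAt (order A) y)
  ; irrefl = λ { {x} refl → irreflJ (splitAt (order A) x) }
  }
  where
  module A = Graph A
  module B = Graph B

  AdjJ : Rel (A.V ⊎ B.V) 0ℓ
  AdjJ (inj₁ u) (inj₁ v) = A.Adj u v
  AdjJ (inj₁ _) (inj₂ _) = ⊤
  AdjJ (inj₂ _) (inj₁ _) = ⊤
  AdjJ (inj₂ u) (inj₂ v) = B.Adj u v

  adjJ? : Decidable AdjJ
  adjJ? (inj₁ u) (inj₁ v) = A.adj? u v
  adjJ? (inj₁ _) (inj₂ _) = yes tt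
  adjJ? (inj₂ _) (inj₁ _) = yes tt
  adjJ? (inj₂ u) (inj₂ v) = B.adj? u v

  symmJ : ∀ s t → AdjJ s t → AdjJ t s
  symmJ (inj₁ _) (inj₁ _) = A.symm
  symmJ (inj₁ _) (inj₂ _) = λ _ → tt
  symmJ (inj₂ _) (inj₁ _) = λ _ → tt
  symmJ (inj₂ _) (inj₂ _) = B.symm

  irreflJ : ∀ s → ¬ AdjJ s s
  irreflJ (inj₁ _) = A.irrefl refl
  irreflJ (inj₂ _) = B.irrefl refl

⌈_/_⌉ : (m n : ℕ) .{{_ : NonZero n}} → ℕ
⌈ m / n ⌉ = (m + pred n) / n

extremal : (k d b : ℕ) → Graph
extremal k d b = copies b (complete (suc k)) ∨ edgeless (d ∸ k)

{-# OPTIONS --safe #-}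

-- Let S be a minimal k-tuple total dominating set.  If v ∈ S, then S - v no
-- longer dominates, so some vertex x has exactly k neighbours in S; its other
-- neighbours, at least δ - k of them, lie outside S, whence ∣ S ∣ ≤ n - δ + k.
-- In the join of a k-regular graph A (k ≥ 1) with a graph B, the set V(A)
-- attains the bound: a vertex u of A cannot be removed from V(A), since a
-- neighbour of u in A has exactly k neighbours in V(A), one of which is u.
module Submission where

open import Defs
open import Data.Empty using () renaming (⊥ to Empty)
open import Data.Bool.Base using (_∧_)
open import Data.Fin.Base using (Fin; zero; suc; splitAt; remQuot; _↑ˡ_; _↑ʳ_; fromℕ<)
open import Data.Fin.Properties
  using (_≟_; ¬∀⟶∃¬; splitAt-↑ˡ; splitAt-↑ʳ; join-splitAt)
open import Data.Fin.Subset
  using (Subset; Side; inside; outside; ∣_∣; ⊤; ⊥; _∪_; _∩_; ⁅_⁆; _-_; _∈_; _∉_; _⊆_; _⊂_; Nonempty)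
open import Data.Fin.Subset.Properties
  using (∣p∣≤n; ∣⊤∣≡n; ∣⊥∣≡0; ∉⊥; nonempty?; Empty-unique; p⊆q⇒∣p∣≤∣q∣; p⊂q⇒∣p∣<∣q∣;
         ∣⁅x⁆∣≡1; x∈⁅x⁆; x∈p∪q⁺; x∈p∩q⁺; x∈p∩q⁻; ∩-identityʳ; ∩-zeroʳ;
         x∈p∧x≢y⇒x∈p-y; x∈p⇒p-x⊂p)
open import Data.List.Base using (allFin; map)
open import Data.List.Extrema.Nat using (max≤v⁺; xs≤max; v≤min⁺; min≤xs; min≤⊤)
open import Data.List.Membership.Propositional using () renaming (_∈_ to _∈ˡ_)
open import Data.List.Membership.Propositional.Properties
  using (∈-map⁺; ∈-filter⁺; ∈-++⁺ˡ; ∈-++⁺ʳ; ∈-allFin)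
import Data.List.Relation.Unary.All as All
open import Data.List.Relation.Unary.All.Properties using (map⁺; all-filter)
open import Data.List.Relation.Unary.Any using (here)
open import Data.Nat.Base using (ℕ; zero; suc; _+_; _*_; _∸_; _≤_; _<_; _≥_; z≤n; s≤s; s≤s⁻¹)
open import Data.Nat.DivMod using (_%_; m≡m%n+[m/n]*n; m%n<n)
open import Data.Nat.Properties hiding (_≟_)
open import Data.Product.Base using (_×_; _,_; proj₁; proj₂; map₁)
open import Data.Sum.Base using (inj₁; inj₂)
open import Data.Vec.Base as Vec using ([]; _∷_; _++_; tabulate)
open import Data.Vec.Properties
  using (tabulate-cong; zipWith-++; []=⇒lookup; lookup⇒[]=; lookup∘tabulate; lookup-++ˡ; lookup-++ʳ)
open import Function.Base using (_∘_; const)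
open import Relation.Binary.PropositionalEquality
open import Relation.Nullary using (yes; no; does; ¬_; contradiction)
open import Relation.Nullary.Decidable using (dec-true; dec-false)
open Graph using (order; N; V; Adj; adj?; symm; degree)

private
  variable
    b m n : ℕ
    A : Set

-- Cardinalities of finite subsets

∣p∪q∣+∣p∩q∣≡∣p∣+∣q∣ : ∀ (p q : Subset n) → ∣ p ∪ q ∣ + ∣ p ∩ q ∣ ≡ ∣ p ∣ + ∣ q ∣
∣p∪q∣+∣p∩q∣≡∣p∣+∣q∣ []            []            = refl
∣p∪q∣+∣p∩q∣≡∣p∣+∣q∣ (outside ∷ p) (outside ∷ q) = ∣p∪q∣+∣p∩q∣≡∣p∣+∣q∣ p q
∣p∪q∣+∣p∩q∣≡∣p∣+∣q∣ (inside ∷ p)  (outside ∷ q) = cong suc (∣p∪q∣+∣p∩q∣≡∣p∣+∣q∣ p q)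
∣p∪q∣+∣p∩q∣≡∣p∣+∣q∣ (outside ∷ p) (inside ∷ q)  =
  trans (cong suc (∣p∪q∣+∣p∩q∣≡∣p∣+∣q∣ p q)) (sym (+-suc _ _))
∣p∪q∣+∣p∩q∣≡∣p∣+∣q∣ (inside ∷ p)  (inside ∷ q)  = cong suc
  (trans (+-suc _ _) (trans (cong suc (∣p∪q∣+∣p∩q∣≡∣p∣+∣q∣ p q)) (sym (+-suc _ _))))

-- Inclusion-exclusion, with the union bounded by the ground set. The upper bound applies it to a
-- neighbourhood and a dominating set.
∣p∣+∣q∣≤n+∣p∩q∣ : ∀ (p q : Subset n) → ∣ p ∣ + ∣ q ∣ ≤ n + ∣ p ∩ q ∣
∣p∣+∣q∣≤n+∣p∩q∣ {n} p q =
  subst (_≤ n + ∣ p ∩ q ∣) (∣p∪q∣+∣p∩q∣≡∣p∣+∣q∣ p q) (+-monoˡ-≤ _ (∣p∣≤n (p ∪ q)))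

-- The set `p ∩ q` is covered by `p ∩ (q - x)` and the singleton of `x`.
∣p∩q∣≤1+∣p∩[q-x]∣ : ∀ (p q : Subset n) x → ∣ p ∩ q ∣ ≤ suc ∣ p ∩ (q - x) ∣
∣p∩q∣≤1+∣p∩[q-x]∣ p q x = begin
  ∣ p ∩ q ∣                             ≤⟨ p⊆q⇒∣p∣≤∣q∣ p∩q⊆ ⟩
  ∣ r ∪ ⁅ x ⁆ ∣                         ≤⟨ m≤m+n _ _ ⟩
  ∣ r ∪ ⁅ x ⁆ ∣ + ∣ r ∩ ⁅ x ⁆ ∣         ≡⟨ ∣p∪q∣+∣p∩q∣≡∣p∣+∣q∣ r ⁅ x ⁆ ⟩
  ∣ r ∣ + ∣ ⁅ x ⁆ ∣                     ≡⟨ cong (∣ r ∣ +_) (∣⁅x⁆∣≡1 x) ⟩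
  ∣ r ∣ + 1                             ≡⟨ +-comm ∣ r ∣ 1 ⟩
  suc ∣ r ∣                             ∎
  where
  open ≤-Reasoning
  r = p ∩ (q - x)

  p∩q⊆ : p ∩ q ⊆ r ∪ ⁅ x ⁆
  p∩q⊆ {y} y∈ with y ≟ x | x∈p∩q⁻ p q y∈
  ... | yes refl | _         = x∈p∪q⁺ (inj₂ (x∈⁅x⁆ x))
  ... | no y≢x   | y∈p , y∈q = x∈p∪q⁺ (inj₁ (x∈p∩q⁺ (y∈p , x∈p∧x≢y⇒x∈p-y y∈q y≢x)))

∣p∣>0⇒Nonempty : ∀ (p : Subset n) → 0 < ∣ p ∣ → Nonempty p
∣p∣>0⇒Nonempty {n} p 0<∣p∣ with nonempty? p
... | yes ne = ne
... | no ¬ne = contradiction (trans (cong ∣_∣ (Empty-unique ¬ne)) (∣⊥∣≡0 n)) (>⇒≢ 0<∣p∣)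

∣++∣ : ∀ (p : Subset m) (q : Subset n) → ∣ p ++ q ∣ ≡ ∣ p ∣ + ∣ q ∣
∣++∣ []            q = refl
∣++∣ (outside ∷ p) q = ∣++∣ p q
∣++∣ (inside ∷ p)  q = cong suc (∣++∣ p q)

∣tabulate-outside∣≡0 : ∀ {f : Fin n → Side} → (∀ x → f x ≡ outside) → ∣ tabulate f ∣ ≡ 0
∣tabulate-outside∣≡0 {zero}  f≗∅ = refl
∣tabulate-outside∣≡0 {suc n} f≗∅ rewrite f≗∅ zero = ∣tabulate-outside∣≡0 (f≗∅ ∘ suc)

tabulate-const : ∀ n (x : A) → tabulate {n = n} (const x) ≡ Vec.replicate n x
tabulate-const zero    x = refl
tabulate-const (suc n) x = cong (x ∷_) (tabulate-const n x)

tabulate-+ : ∀ m {n} (f : Fin (m + n) → A) →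
             tabulate f ≡ tabulate (f ∘ (_↑ˡ n)) ++ tabulate (f ∘ (m ↑ʳ_))
tabulate-+ zero    f = refl
tabulate-+ (suc m) f = cong (f zero ∷_) (tabulate-+ m (f ∘ suc))

-- Induction on the number of blocks. Either the first block is block `i` and the others contribute
-- nothing, or it contributes nothing itself and the induction hypothesis handles the rest.
∣tabulate∘remQuot∣ : ∀ n (g : Fin b × Fin n → Side) i →
                     (∀ j u → i ≢ j → g (j , u) ≡ outside) →
                     ∣ tabulate (g ∘ remQuot {b} n) ∣ ≡ ∣ tabulate (λ u → g (i , u)) ∣
∣tabulate∘remQuot∣ {suc b} n g i g≡∅ = begin
  ∣ tabulate (g ∘ remQuot {suc b} n) ∣                  ≡⟨ cong ∣_∣ (tabulate-+ n _) ⟩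
  ∣ tabulate (g ∘ remQuot {suc b} n ∘ (_↑ˡ (b * n)))
    ++ tabulate (g ∘ remQuot {suc b} n ∘ (n ↑ʳ_)) ∣     ≡⟨ cong₂ (λ p q → ∣ p ++ q ∣)
                                                                 (tabulate-cong first) (tabulate-cong rest) ⟩
  ∣ firstBlock ++ otherBlocks ∣                         ≡⟨ ∣++∣ firstBlock otherBlocks ⟩
  ∣ firstBlock ∣ + ∣ otherBlocks ∣                      ≡⟨ split i g≡∅ ⟩
  ∣ tabulate (λ u → g (i , u)) ∣                        ∎
  where
  open ≡-Reasoning
  firstBlock  = tabulate (λ u → g (zero , u))
  otherBlocks = tabulate (g ∘ map₁ suc ∘ remQuot {b} n)

  first : ∀ u → g (remQuot {suc b} n (u ↑ˡ (b * n))) ≡ g (zero , u)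
  first u rewrite splitAt-↑ˡ n u (b * n) = refl

  rest : ∀ y → g (remQuot {suc b} n (n ↑ʳ y)) ≡ g (map₁ suc (remQuot {b} n y))
  rest y rewrite splitAt-↑ʳ n (b * n) y = refl

  split : ∀ i → (∀ j u → i ≢ j → g (j , u) ≡ outside) →
          ∣ firstBlock ∣ + ∣ otherBlocks ∣ ≡ ∣ tabulate (λ u → g (i , u)) ∣
  split zero    g≡∅ = trans
    (cong (∣ firstBlock ∣ +_) (∣tabulate-outside∣≡0 λ y →
      g≡∅ (suc (proj₁ (remQuot {b} n y))) (proj₂ (remQuot {b} n y)) λ ()))
    (+-identityʳ _)
  split (suc i) g≡∅ = cong₂ _+_
    (∣tabulate-outside∣≡0 λ u → g≡∅ zero u λ ())
    (∣tabulate∘remQuot∣ n (g ∘ map₁ suc) i λ j u i≢j → g≡∅ (suc j) u λ { refl → i≢j refl })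

-- Minimum degree and upper domination number

N⁺ : ∀ G {x y} → Adj G x y → y ∈ N G x
N⁺ G {x} {y} xy = lookup⇒[]= y _
  (trans (lookup∘tabulate _ y) (dec-true (adj? G x y) xy))

N⁻ : ∀ G {x y} → y ∈ N G x → Adj G x y
N⁻ G {x} {y} y∈Nx with adj? G x y | trans (sym (lookup∘tabulate (does ∘ adj? G x) y)) ([]=⇒lookup y∈Nx)
... | yes xy | _ = xy

N-sym : ∀ G {x y} → y ∈ N G x → x ∈ N G y
N-sym G = N⁺ G ∘ symm G ∘ N⁻ G

δ≤order : ∀ G → δ G ≤ order G
δ≤order G = min≤⊤ (order G) (map (degree G) (allFin (order G)))

δ≤degree : ∀ G x → δ G ≤ degree G x
δ≤degree G x = All.lookup (min≤xs (order G) (map (degree G) (allFin (order G))))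
                          (∈-map⁺ (degree G) (∈-allFin x))

-- The bound on the order covers the initial value of the minimum that defines `δ`.
≤δ : ∀ G → m ≤ order G → (∀ x → m ≤ degree G x) → m ≤ δ G
≤δ G m≤n m≤deg = v≤min⁺ m≤n (map⁺ {xs = allFin (order G)} (All.tabulate λ {x} _ → m≤deg x))

∈-allSubsets : ∀ (p : Subset n) → p ∈ˡ allSubsets n
∈-allSubsets []            = here refl
∈-allSubsets (outside ∷ p) = ∈-++⁺ˡ (∈-map⁺ (outside ∷_) (∈-allSubsets p))
∈-allSubsets (inside ∷ p)  = ∈-++⁺ʳ _ (∈-map⁺ (inside ∷_) (∈-allSubsets p))

∣S∣≤Γ : ∀ k G {S} → IsMinimalTDS k G S → ∣ S ∣ ≤ Γ k G
∣S∣≤Γ k G {S} minS = All.lookup (xs≤max 0 _)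
  (∈-map⁺ ∣_∣ (∈-filter⁺ (isMinimalTDS? k G) (∈-allSubsets S) minS))

Γ≤ : ∀ k G → (∀ S → IsMinimalTDS k G S → ∣ S ∣ ≤ m) → Γ k G ≤ m
Γ≤ k G bound = max≤v⁺ z≤n
  (map⁺ (All.map (bound _) (all-filter (isMinimalTDS? k G) (allSubsets (order G)))))

-- The upper bound for minimal dominating sets

∣S∣≤n∸δ+k : ∀ k G S → IsMinimalTDS k G S → ∣ S ∣ ≤ order G ∸ δ G + k
∣S∣≤n∸δ+k k G S (_ , minimal) with nonempty? S
... | no ¬ne = subst (_≤ _) (sym (trans (cong ∣_∣ (Empty-unique ¬ne)) (∣⊥∣≡0 (order G)))) z≤n
... | yes (v , v∈S)
  -- Minimality rules out `S - v`; since the domination condition is decidable at each vertex, a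
  -- concrete vertex `x` violates it.
  with x , ¬dominated ← ¬∀⟶∃¬ (order G) (λ x → ∣ N G x ∩ (S - v) ∣ ≥ k)
                          (λ x → ∣ N G x ∩ (S - v) ∣ ≥? k)
                          (λ tds → minimal (S - v , x∈p⇒p-x⊂p v∈S , tds))
  = begin
    ∣ S ∣                 ≤⟨ ∣S∣≤n+k∸δ ⟩
    order G + k ∸ δ G     ≡⟨ +-∸-comm k (δ≤order G) ⟩
    order G ∸ δ G + k     ∎
  where
  open ≤-Reasoning
  ∣S∣≤n+k∸δ : ∣ S ∣ ≤ order G + k ∸ δ G
  ∣S∣≤n+k∸δ = m+n≤o⇒m≤o∸n ∣ S ∣ (begin
    ∣ S ∣ + δ G                ≤⟨ +-monoʳ-≤ ∣ S ∣ (δ≤degree G x) ⟩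
    ∣ S ∣ + ∣ N G x ∣          ≡⟨ +-comm ∣ S ∣ _ ⟩
    ∣ N G x ∣ + ∣ S ∣          ≤⟨ ∣p∣+∣q∣≤n+∣p∩q∣ (N G x) S ⟩
    -- Fewer than `k` neighbours of `x` lie in `S - v`, and restoring `v` adds at most one.
    order G + ∣ N G x ∩ S ∣    ≤⟨ +-monoʳ-≤ (order G) (≤-trans (∣p∩q∣≤1+∣p∩[q-x]∣ (N G x) S v) (≰⇒> ¬dominated)) ⟩
    order G + k                ∎)

Γ≤n∸δ+k : ∀ k G → Γ k G ≤ order G ∸ δ G + k
Γ≤n∸δ+k k G = Γ≤ k G (∣S∣≤n∸δ+k k G)

-- Complete graphs, copies and joins

-- The adjacency row of `zero` is `outside` followed by `k` entries `inside`; that of `suc x` is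
-- `inside` followed by the row of `x` in the complete graph with one vertex fewer.
complete-degree : ∀ k x → degree (complete (suc k)) x ≡ k
complete-degree k       zero    = trans (cong ∣_∣ (tabulate-const k inside)) (∣⊤∣≡n k)
complete-degree (suc k) (suc x) = cong suc (complete-degree k x)

-- All neighbours of `x` lie in its own copy, so the count collapses to that block, where the test
-- on copy indices always succeeds.
copies-degree : ∀ b G x →
                degree (copies b G) x ≡ degree G (proj₂ (remQuot {b} (order G) x))
copies-degree b G x =
  trans (∣tabulate∘remQuot∣ (order G) (λ (j , v) → does (i ≟ j) ∧ does (adj? G u v)) i
          λ j v i≢j → cong (_∧ _) (dec-false (i ≟ j) i≢j))
        (cong ∣_∣ (tabulate-cong λ v → cong (_∧ does (adj? G u v)) (dec-true (i ≟ i) refl)))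
  where
  i = proj₁ (remQuot {b} (order G) x)
  u = proj₂ (remQuot {b} (order G) x)

↑-elim : ∀ (P : Fin (m + n) → Set) →
         (∀ u → P (u ↑ˡ n)) → (∀ v → P (m ↑ʳ v)) → ∀ x → P x
↑-elim {m} {n} P left right x with splitAt m x | join-splitAt m n x
... | inj₁ u | refl = left u
... | inj₂ v | refl = right v

module _ (A B : Graph) where

  -- Writing neighbourhoods as concatenations reduces counting in the join to counting on each side.
  N-∨ˡ : ∀ u → N (A ∨ B) (u ↑ˡ order B) ≡ N A u ++ ⊤
  N-∨ˡ u = trans (tabulate-+ (order A) _)
    (cong₂ _++_ (tabulate-cong left)
                (trans (tabulate-cong right) (tabulate-const (order B) inside)))
    where
    left : ∀ w → does (adj? (A ∨ B) (u ↑ˡ order B) (w ↑ˡ order B)) ≡ does (adj? A u w)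
    left w rewrite splitAt-↑ˡ (order A) u (order B) | splitAt-↑ˡ (order A) w (order B) = refl

    right : ∀ w → does (adj? (A ∨ B) (u ↑ˡ order B) (order A ↑ʳ w)) ≡ inside
    right w rewrite splitAt-↑ˡ (order A) u (order B) | splitAt-↑ʳ (order A) (order B) w = refl

  N-∨ʳ : ∀ v → N (A ∨ B) (order A ↑ʳ v) ≡ ⊤ ++ N B v
  N-∨ʳ v = trans (tabulate-+ (order A) _)
    (cong₂ _++_ (trans (tabulate-cong left) (tabulate-const (order A) inside))
                (tabulate-cong right))
    where
    left : ∀ w → does (adj? (A ∨ B) (order A ↑ʳ v) (w ↑ˡ order B)) ≡ inside
    left w rewrite splitAt-↑ʳ (order A) (order B) v | splitAt-↑ˡ (order A) w (order B) = refl

    right : ∀ w → does (adj? (A ∨ B) (order A ↑ʳ v) (order A ↑ʳ w)) ≡ does (adj? B v w)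
    right w rewrite splitAt-↑ʳ (order A) (order B) v | splitAt-↑ʳ (order A) (order B) w = refl

  degree-∨ˡ : ∀ u → degree (A ∨ B) (u ↑ˡ order B) ≡ degree A u + order B
  degree-∨ˡ u = trans (cong ∣_∣ (N-∨ˡ u))
    (trans (∣++∣ (N A u) ⊤) (cong (degree A u +_) (∣⊤∣≡n (order B))))

  degree-∨ʳ : ∀ v → degree (A ∨ B) (order A ↑ʳ v) ≡ order A + degree B v
  degree-∨ʳ v = trans (cong ∣_∣ (N-∨ʳ v))
    (trans (∣++∣ (⊤ {order A}) (N B v)) (cong (_+ degree B v) (∣⊤∣≡n (order A))))

  V-left : Subset (order (A ∨ B))
  V-left = ⊤ {order A} ++ ⊥ {order B}

  ∣++∩V-left∣ : ∀ (p : Subset (order A)) (q : Subset (order B)) → ∣ (p ++ q) ∩ V-left ∣ ≡ ∣ p ∣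
  ∣++∩V-left∣ p q = begin
    ∣ (p ++ q) ∩ V-left ∣      ≡⟨ cong ∣_∣ (zipWith-++ _ p q ⊤ ⊥) ⟩
    ∣ (p ∩ ⊤) ++ (q ∩ ⊥) ∣     ≡⟨ cong₂ (λ s t → ∣ s ++ t ∣) (∩-identityʳ p) (∩-zeroʳ q) ⟩
    ∣ p ++ ⊥ {order B} ∣       ≡⟨ ∣++∣ p (⊥ {order B}) ⟩
    ∣ p ∣ + ∣ ⊥ {order B} ∣    ≡⟨ cong (∣ p ∣ +_) (∣⊥∣≡0 (order B)) ⟩
    ∣ p ∣ + 0                  ≡⟨ +-identityʳ ∣ p ∣ ⟩
    ∣ p ∣                      ∎
    where open ≡-Reasoning

  ∣V-left∣ : ∣ V-left ∣ ≡ order A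
  ∣V-left∣ = trans (∣++∣ (⊤ {order A}) (⊥ {order B}))
    (trans (cong₂ _+_ (∣⊤∣≡n (order A)) (∣⊥∣≡0 (order B))) (+-identityʳ _))

  -- The vertex set of a regular graph as a minimal dominating set of a join

  module _ {k : ℕ} (k>0 : 0 < k) (regular : ∀ u → degree A u ≡ k) (k≤∣A∣ : k ≤ order A) where

    ∣N∩V-left∣ : ∀ u → ∣ N (A ∨ B) (u ↑ˡ order B) ∩ V-left ∣ ≡ k
    ∣N∩V-left∣ u = trans (cong (λ p → ∣ p ∩ V-left ∣) (N-∨ˡ u))
                         (trans (∣++∩V-left∣ (N A u) ⊤) (regular u))

    V-left-isTDS : IsTDS k (A ∨ B) V-left
    V-left-isTDS = ↑-elim {order A} _
      (λ u → ≤-reflexive (sym (∣N∩V-left∣ u)))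
      -- A vertex of `B` is adjacent to all of `A`, hence to at least `k` vertices of `V-left`.
      (λ v → ≤-trans k≤∣A∣ (≤-reflexive (sym
        (trans (cong (λ p → ∣ p ∩ V-left ∣) (N-∨ʳ v))
               (trans (∣++∩V-left∣ ⊤ (N B v)) (∣⊤∣≡n (order A)))))))

    V-left-minimal : ∀ T → T ⊂ V-left → ¬ IsTDS k (A ∨ B) T
    V-left-minimal T (T⊆S , x , x∈S , x∉T) tds =
      ↑-elim {order A} (λ x → x ∈ V-left → x ∉ T → Empty) left right x x∈S x∉T
      where
      left : ∀ u → u ↑ˡ order B ∈ V-left → u ↑ˡ order B ∉ T → Empty
      left u u∈S u∉T with w , w∈Nu ← ∣p∣>0⇒Nonempty (N A u) (subst (0 <_) (sym (regular u)) k>0) =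
        -- The neighbour `w` of `u` has exactly `k` neighbours in `V-left`; `T` misses `u`, so fewer
        -- than `k` of them remain.
        <⇒≱ (subst (∣ Nw ∩ T ∣ <_) (∣N∩V-left∣ w) (p⊂q⇒∣p∣<∣q∣ loses-u)) (tds (w ↑ˡ order B))
        where
        Nw = N (A ∨ B) (w ↑ˡ order B)

        u∈Nw : u ↑ˡ order B ∈ Nw
        u∈Nw = subst (u ↑ˡ order B ∈_) (sym (N-∨ˡ w))
          (lookup⇒[]= _ _ (trans (lookup-++ˡ (N A w) ⊤ u) ([]=⇒lookup (N-sym A w∈Nu))))

        loses-u : Nw ∩ T ⊂ Nw ∩ V-left
        loses-u = (λ y∈ → let y∈N , y∈T = x∈p∩q⁻ Nw T y∈ in x∈p∩q⁺ (y∈N , T⊆S y∈T))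
                , u ↑ˡ order B , x∈p∩q⁺ (u∈Nw , u∈S) , u∉T ∘ proj₂ ∘ x∈p∩q⁻ Nw T

      right : ∀ v → order A ↑ʳ v ∈ V-left → order A ↑ʳ v ∉ T → Empty
      -- Vacuous case: `V-left` contains no vertex of `B`.
      right v v∈S _ = ∉⊥ (lookup⇒[]= v ⊥
        (trans (sym (lookup-++ʳ (⊤ {order A}) ⊥ v)) ([]=⇒lookup v∈S)))

    V-left-isMinimalTDS : IsMinimalTDS k (A ∨ B) V-left
    V-left-isMinimalTDS = V-left-isTDS , λ (T , T⊂S , tds) → V-left-minimal T T⊂S tds

    order≤Γ : order A ≤ Γ k (A ∨ B)
    order≤Γ = subst (_≤ Γ k (A ∨ B)) ∣V-left∣ (∣S∣≤Γ k (A ∨ B) V-left-isMinimalTDS)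

-- The extremal graphs

-- The ceiling is the quotient of `m + n` by `suc n`. The remainder of that division is at most `n`,
-- and cancelling `n` leaves the claim.
m≤⌈m/1+n⌉*[1+n] : ∀ m n → m ≤ ⌈ m / suc n ⌉ * suc n
m≤⌈m/1+n⌉*[1+n] m n = +-cancelʳ-≤ n m _ (begin
  m + n                                             ≡⟨ m≡m%n+[m/n]*n (m + n) (suc n) ⟩
  (m + n) % suc n + ⌈ m / suc n ⌉ * suc n           ≤⟨ +-monoˡ-≤ _ (s≤s⁻¹ (m%n<n (m + n) (suc n))) ⟩
  n + ⌈ m / suc n ⌉ * suc n                         ≡⟨ +-comm n _ ⟩
  ⌈ m / suc n ⌉ * suc n + n                         ∎)
  where open ≤-Reasoning

module _ (k d b : ℕ) (k<d : k < d) (d≤b[1+k] : d ≤ b * suc k) where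
  private
    H = copies b (complete (suc k))
    T = edgeless (d ∸ k)
    k≤d = <⇒≤ k<d

  H-regular : ∀ u → degree H u ≡ k
  H-regular u = trans (copies-degree b (complete (suc k)) u)
    (complete-degree k (proj₂ (remQuot {b} (suc k) u)))

  degree-left : ∀ u → degree (H ∨ T) (u ↑ˡ (d ∸ k)) ≡ d
  degree-left u = trans (degree-∨ˡ H T u)
    (trans (cong (_+ (d ∸ k)) (H-regular u)) (m+[n∸m]≡n k≤d))

  -- Vertices of `H` have degree `k + (d ∸ k)`, which is `d`. Vertices of `T` see all of `H`, so
  -- their degree is at least `b * suc k`, hence at least `d`.
  δ-extremal : δ (extremal k d b) ≡ d
  δ-extremal = ≤-antisym
    (subst (δ (H ∨ T) ≤_) (degree-left u₀) (δ≤degree (H ∨ T) (u₀ ↑ˡ (d ∸ k))))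
    (≤δ (H ∨ T) (≤-trans d≤b[1+k] (m≤m+n _ _))
      (↑-elim {order H} _
        (λ u → ≤-reflexive (sym (degree-left u)))
        (λ v → ≤-trans d≤b[1+k] (≤-trans (m≤m+n _ _) (≤-reflexive (sym (degree-∨ʳ H T v)))))))
    where
    u₀ : V H
    -- `H` has a vertex because `0 < d ≤ b * suc k`; its degree attains the minimum.
    u₀ = fromℕ< (<-≤-trans (≤-<-trans z≤n k<d) d≤b[1+k])

  -- Identifies the upper bound with the order of `H`, the size of `V-left`. The final cancellation
  -- is sound for truncated subtraction because `k ≤ d ≤ b * suc k`.
  n∸d+k≡b[1+k] : b * suc k + (d ∸ k) ∸ d + k ≡ b * suc k
  n∸d+k≡b[1+k] = begin
    b * suc k + (d ∸ k) ∸ d + k    ≡⟨ cong (λ z → z ∸ d + k) (+-∸-assoc (b * suc k) k≤d) ⟨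
    b * suc k + d ∸ k ∸ d + k      ≡⟨ cong (_+ k) (∸-+-assoc (b * suc k + d) k d) ⟩
    b * suc k + d ∸ (k + d) + k    ≡⟨ cong (_+ k) ([m+n]∸[o+n]≡m∸o (b * suc k) d k) ⟩
    b * suc k ∸ k + k              ≡⟨ m∸n+n≡m (≤-trans k≤d d≤b[1+k]) ⟩
    b * suc k                      ∎
    where
    open ≡-Reasoning
    [m+n]∸[o+n]≡m∸o : ∀ m n o → m + n ∸ (o + n) ≡ m ∸ o
    [m+n]∸[o+n]≡m∸o m n o = trans (cong₂ _∸_ (+-comm m n) (+-comm o n)) ([m+n]∸[m+o]≡n∸o n m o)

  Γ-extremal : 0 < k → Γ k (extremal k d b) ≡ order (extremal k d b) ∸ d + k
  Γ-extremal k>0 = ≤-antisym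
    (subst (λ e → Γ k (H ∨ T) ≤ order (H ∨ T) ∸ e + k) δ-extremal (Γ≤n∸δ+k k (H ∨ T)))
    (subst (_≤ Γ k (H ∨ T)) (sym n∸d+k≡b[1+k])
      (order≤Γ H T k>0 H-regular (≤-trans k≤d d≤b[1+k])))

mainTheorem6 : (∀ (k : ℕ) (G : Graph) → k ≥ 1 → δ G ≥ k + 1 →
    Γ k G ≤ Graph.order G ∸ δ G + k)
    ×
    (∀ (k d b : ℕ) → k + 1 ≥ 2 → d ≥ k + 1 → b ≥ ⌈ d / suc k ⌉ →
    let Gb = extremal k d b
        n = Graph.order Gb in
    δ Gb ≡ d × n ≡ b * (k + 1) + (d ∸ k) × Γ k Gb ≡ n ∸ d + k)
mainTheorem6 = (λ k G _ _ → Γ≤n∸δ+k k G) , λ k d b k+1≥2 d≥k+1 b≥ →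
  let k<d      = subst (_≤ d) (+-comm k 1) d≥k+1
      -- The ceiling condition on `b` says that `H` has at least `d` vertices.
      d≤b[1+k] = ≤-trans (m≤⌈m/1+n⌉*[1+n] d k) (*-monoˡ-≤ (suc k) b≥)
  in δ-extremal k d b k<d d≤b[1+k]
   , cong (λ z → b * z + (d ∸ k)) (+-comm 1 k)
   , Γ-extremal k d b k<d d≤b[1+k] (+-cancelʳ-≤ 1 1 k k+1≥2)
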